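{- For all integers $m<0$ and $n\geq 1$, \[ M(\leq m,n)\leq N(\leq m+1,n). \]
   Context: For a partition $\lambda$, $\operatorname{rank}(\lambda)$ is its largest part minus its number of parts. $\operatorname{crank}(\lambda)$ is the largest part of $\lambda$ if $\lambda$ contains no part equal to $1$; otherwise it is the number of parts larger than the number of ones minus the number of ones. For $n\geq 1$, $N(m,n)$ is the number of partitions of $n$ with rank $m$. For $n>1$, $M(m,n)$ is the number of partitions of $n$ with crank $m$. For $n=1$ one sets $M(0,1)=-1$, $M(1,1)=M(-1,1)=1$ and $M(m,1)=0$ for $m\notin\{ -1,0,1\}$. The cumulative functions are $N(\leq m,n)=\sum_{r\leq m}N(r,n)$ and $M(\leq m,n)=\sum_{r\leq m}M(r,n)$. -}

module Defs where

open import Data.Nat.Base as ℕ using (ℕ; zero; suc; _∸_; _⊓_; _≥_; z≤n; s≤s)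
import Data.Nat.Properties as ℕ
open import Data.Integer.Base using (ℤ; +_; -[1+_]; _+_; _⊖_; 0ℤ; 1ℤ; -1ℤ; ∣_∣)
import Data.Integer.Properties as ℤ
open import Data.List.Base using (List; []; _∷_; map; filter; length; foldr; concatMap; upTo)
import Data.List.Properties as List
open import Data.Nat.ListAction using (sum)
open import Data.List.Extrema.Nat using (max; max≤v⁺)
open import Data.List.Membership.Propositional using (_∈_; lose; find)
open import Data.List.Membership.Propositional.Properties using (∈-map⁺; ∈-map⁻; ∈-concatMap⁺; ∈-concatMap⁻; ∈-upTo⁺; ∈-upTo⁻)
open import Data.List.Relation.Unary.All as All using (All; []; _∷_)
import Data.List.Relation.Unary.All.Properties as All
open import Data.List.Relation.Unary.Any using (here)
import Data.List.Relation.Unary.AllPairs as AllPairs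
import Data.List.Relation.Unary.AllPairs.Properties as AllPairs
open import Data.List.Relation.Unary.Linked using (Linked; []; [-]; _∷_)
open import Data.List.Relation.Unary.Unique.Propositional using (Unique; []; _∷_)
import Data.List.Relation.Unary.Unique.Propositional.Properties as Unique
open import Data.List.Relation.Binary.Disjoint.Propositional using (Disjoint)
open import Data.Product.Base using (_×_; _,_; proj₁; proj₂)
open import Relation.Binary.PropositionalEquality using (_≡_; _≢_; refl; sym; trans; cong; subst)

record IsPartition (n : ℕ) (ps : List ℕ) : Set where
  constructor isPartition
  field
    nonincreasing : Linked _≥_ ps
    positive      : All (ℕ._<_ 0) ps
    sums-to       : sum ps ≡ n

-- The partitions of n into at most `fuel` parts, each at most k.
boundedPartitions : (fuel k n : ℕ) → List (List ℕ)
boundedPartitions _          k zero    = [] ∷ []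
boundedPartitions zero       k (suc n) = []
boundedPartitions (suc fuel) k (suc n) =
  concatMap (λ i → map (suc i ∷_) (boundedPartitions fuel (suc i) (n ∸ i)))
            (upTo (k ⊓ suc n))

-- By partitions-sound, partitions-complete and partitions-unique below, this
-- list contains each partition of n exactly once and nothing else.
partitions : ℕ → List (List ℕ)
partitions n = boundedPartitions n n n

largestPart : List ℕ → ℕ
largestPart = max 0

rank : List ℕ → ℤ
rank ps = largestPart ps ⊖ length ps

ones : List ℕ → ℕ
ones ps = length (filter (ℕ._≟ 1) ps)

partsLargerThan : ℕ → List ℕ → ℕ
partsLargerThan w ps = length (filter (w ℕ.<?_) ps)

crank : List ℕ → ℤ
crank ps with ones ps
... | zero      = + largestPart ps
... | w@(suc _) = partsLargerThan w ps ⊖ w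

N : ℤ → ℕ → ℕ
N m n = length (filter (λ ps → rank ps ℤ.≟ m) (partitions n))

crankCount : ℤ → ℕ → ℕ
crankCount m n = length (filter (λ ps → crank ps ℤ.≟ m) (partitions n))

M₁ : ℤ → ℤ
M₁ (+ 0)    = -1ℤ
M₁ (+ 1)    = 1ℤ
M₁ -[1+ 0 ] = 1ℤ
M₁ _        = 0ℤ

-- The value at n = 0 is a convention that is never used.
M : ℤ → ℕ → ℤ
M m 1 = M₁ m
M m n = + crankCount m n

-- The integers -n, …, n, outside of which N(·,n) and M(·,n) vanish
-- (N-support and M-support below).
window : ℕ → List ℤ
window n = map (_⊖ n) (upTo (suc (n ℕ.+ n)))

-- Σ_{r ≤ m} f(r) for f vanishing outside of -n, …, n.
sum≤ : ℤ → ℕ → (ℤ → ℤ) → ℤ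
sum≤ m n f = foldr _+_ 0ℤ (map f (filter (ℤ._≤? m) (window n)))

N≤ : ℤ → ℕ → ℤ
N≤ m n = sum≤ m n (λ r → + N r n)

M≤ : ℤ → ℕ → ℤ
M≤ m n = sum≤ m n (λ r → M r n)

private
  uncons : ∀ {k x xs} → Linked _≥_ (k ∷ x ∷ xs) → x ℕ.≤ k × Linked _≥_ (x ∷ xs)
  uncons (x≤k ∷ l) = x≤k , l

  tail : ∀ {k xs} → Linked _≥_ (k ∷ xs) → Linked _≥_ xs
  tail [-]     = []
  tail (_ ∷ l) = l

  boundedPartitions-sound : ∀ fuel k n {ps} → ps ∈ boundedPartitions fuel k n →
    Linked _≥_ (k ∷ ps) × All (ℕ._<_ 0) ps × sum ps ≡ n
  boundedPartitions-sound zero       k zero    (here refl) = [-] , [] , refl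
  boundedPartitions-sound (suc fuel) k zero    (here refl) = [-] , [] , refl
  boundedPartitions-sound (suc fuel) k (suc n) ps∈
    with i , i∈ , ps∈i ← find (∈-concatMap⁻ _ {xs = upTo (k ⊓ suc n)} ps∈)
    with qs , qs∈ , refl ← ∈-map⁻ (suc i ∷_) ps∈i
    with l , pos , eq ← boundedPartitions-sound fuel (suc i) (n ∸ i) qs∈
    = ℕ.≤-trans i< (ℕ.m⊓n≤m k (suc n)) ∷ l
    , s≤s z≤n ∷ pos
    , cong suc (trans (cong (i ℕ.+_) eq)
                      (ℕ.m+[n∸m]≡n (ℕ.≤-pred (ℕ.≤-trans i< (ℕ.m⊓n≤n k (suc n))))))
    where i< = ∈-upTo⁻ i∈

  boundedPartitions-complete : ∀ fuel k n ps → n ℕ.≤ fuel →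
    Linked _≥_ (k ∷ ps) → All (ℕ._<_ 0) ps → sum ps ≡ n →
    ps ∈ boundedPartitions fuel k n
  boundedPartitions-complete zero       k zero [] _ _ _ refl = here refl
  boundedPartitions-complete (suc fuel) k zero [] _ _ _ refl = here refl
  boundedPartitions-complete fuel k n (zero ∷ ps) _ _ (() ∷ _) _
  boundedPartitions-complete (suc fuel) k (suc n) (suc i ∷ ps) (s≤s n≤) l (_ ∷ pos) refl =
    ∈-concatMap⁺ _ (lose (∈-upTo⁺ (ℕ.⊓-glb (proj₁ (uncons l)) (s≤s (ℕ.m≤m+n i (sum ps)))))
      (∈-map⁺ (suc i ∷_)
        (boundedPartitions-complete fuel (suc i) (n ∸ i) ps
          (ℕ.≤-trans (ℕ.m∸n≤m n i) n≤) (proj₂ (uncons l)) pos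
          (sym (ℕ.m+n∸m≡n i (sum ps))))))

  boundedPartitions-unique : ∀ fuel k n → Unique (boundedPartitions fuel k n)
  boundedPartitions-unique zero       k zero    = [] ∷ []
  boundedPartitions-unique (suc fuel) k zero    = [] ∷ []
  boundedPartitions-unique zero       k (suc n) = []
  boundedPartitions-unique (suc fuel) k (suc n) =
    Unique.concat⁺
      (All.map⁺ (All.universal
        (λ i → Unique.map⁺ List.∷-injectiveʳ
                 (boundedPartitions-unique fuel (suc i) (n ∸ i)))
        (upTo (k ⊓ suc n))))
      (AllPairs.map⁺ (AllPairs.map disjoint (Unique.upTo⁺ (k ⊓ suc n))))
    where
    disjoint : ∀ {i j} {xss yss : List (List ℕ)} → i ≢ j →
               Disjoint (map (suc i ∷_) xss) (map (suc j ∷_) yss)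
    disjoint {i} {j} i≢j (v∈ , v∈′)
      with _ , _ , refl ← ∈-map⁻ (suc i ∷_) v∈
      with _ , _ , eq   ← ∈-map⁻ (suc j ∷_) v∈′
      = i≢j (ℕ.suc-injective (List.∷-injectiveˡ eq))

partitions-sound : ∀ n {ps} → ps ∈ partitions n → IsPartition n ps
partitions-sound n ps∈ with l , pos , eq ← boundedPartitions-sound n n n ps∈ =
  isPartition (tail l) pos eq

partitions-complete : ∀ n {ps} → IsPartition n ps → ps ∈ partitions n
partitions-complete n {ps} (isPartition l pos eq) =
  boundedPartitions-complete n n n ps ℕ.≤-refl (bound ps l eq) pos eq
  where
  bound : ∀ ps → Linked _≥_ ps → sum ps ≡ n → Linked _≥_ (n ∷ ps)
  bound []       _ _    = [-]
  bound (x ∷ ps) l refl = ℕ.m≤m+n x (sum ps) ∷ l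

partitions-unique : ∀ n → Unique (partitions n)
partitions-unique n = boundedPartitions-unique n n n

private
  parts≤sum : ∀ ps → All (ℕ._≤ sum ps) ps
  parts≤sum []       = []
  parts≤sum (x ∷ ps) = ℕ.m≤m+n x (sum ps)
    ∷ All.map (λ y≤ → ℕ.≤-trans y≤ (ℕ.m≤n+m (sum ps) x)) (parts≤sum ps)

  length≤sum : ∀ {ps} → All (ℕ._<_ 0) ps → length ps ℕ.≤ sum ps
  length≤sum []         = z≤n
  length≤sum (0<x ∷ pos) = ℕ.+-mono-≤ 0<x (length≤sum pos)

  ∣⊖∣≤ : ∀ {a b n} → a ℕ.≤ n → b ℕ.≤ n → ∣ a ⊖ b ∣ ℕ.≤ n
  ∣⊖∣≤ {a} {b} a≤n b≤n = ℕ.≤-trans (ℤ.∣m⊝n∣≤m⊔n a b) (ℕ.⊔-lub a≤n b≤n)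

  largestPart≤ : ∀ {n ps} → IsPartition n ps → largestPart ps ℕ.≤ n
  largestPart≤ {ps = ps} (isPartition _ _ refl) = max≤v⁺ z≤n (parts≤sum ps)

  length≤ : ∀ {n ps} → IsPartition n ps → length ps ℕ.≤ n
  length≤ (isPartition _ pos refl) = length≤sum pos

  count-zero : ∀ (stat : List ℕ → ℤ) n →
    (∀ {ps} → IsPartition n ps → ∣ stat ps ∣ ℕ.≤ n) →
    ∀ m → n ℕ.< ∣ m ∣ → length (filter (λ ps → stat ps ℤ.≟ m) (partitions n)) ≡ 0
  count-zero stat n bound m n<m =
    cong length (List.filter-none (λ ps → stat ps ℤ.≟ m)
      (All.tabulate (λ ps∈ eq →
        ℕ.<⇒≱ n<m (subst (λ r → ∣ r ∣ ℕ.≤ n) eq (bound (partitions-sound n ps∈))))))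

rank-bound : ∀ {n ps} → IsPartition n ps → ∣ rank ps ∣ ℕ.≤ n
rank-bound p = ∣⊖∣≤ (largestPart≤ p) (length≤ p)

crank-bound : ∀ {n ps} → IsPartition n ps → ∣ crank ps ∣ ℕ.≤ n
crank-bound {n} {ps} p
  with ones ps | ℕ.≤-trans (List.length-filter (ℕ._≟ 1) ps) (length≤ p)
... | zero      | _   = largestPart≤ p
... | w@(suc _) | w≤n =
  ∣⊖∣≤ (ℕ.≤-trans (List.length-filter (w ℕ.<?_) ps) (length≤ p)) w≤n

N-support : ∀ m n → n ℕ.< ∣ m ∣ → N m n ≡ 0
N-support m n = count-zero rank n rank-bound m

M-support : ∀ m n → n ℕ.< ∣ m ∣ → M m n ≡ 0ℤ
M-support m               zero            lt = cong +_ (count-zero crank 0 crank-bound m lt)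
M-support (+ 0)           1               ()
M-support (+ 1)           1               (s≤s ())
M-support (+ suc (suc _)) 1               _  = refl
M-support -[1+ 0 ]        1               (s≤s ())
M-support -[1+ suc _ ]    1               _  = refl
M-support m               n@(suc (suc _)) lt = cong +_ (count-zero crank n crank-bound m lt)

{-# OPTIONS --safe #-}
module Submission where

-- Say that λ has a particle at k if λ_{s+1} = k + s for some s ≥ 0 (Dyson: k
-- lies in the rank-set of λ, up to sign).  Let k = - m ≥ 1.
--
-- A partition with w ones has crank ≤ - k iff it has at most w - k parts larger
-- than w; then exactly one v ≤ w is such that merging v of the ones into a
-- single part v produces a particle at k.  Hence M(≤ - k, n) is the number of
-- partitions of n with a particle at k.
--
-- These partitions inject into those of rank ≥ k - 1: if the rank is already
-- ≥ k - 1 nothing is done.  Otherwise remove the first column, of length x, and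
-- the row of the particle at k + 1 if there is one, at k if not, and put all
-- removed cells into a new first row, which is long enough.  In the result, there
-- is no particle at k, and there is one at k - 1 iff the first choice was made,
-- so everything can be undone.  Conjugation turns rank ≥ k - 1 into
-- rank ≤ m + 1.

open import Defs
open import Data.Nat.Base as ℕ using (ℕ; zero; suc; _∸_; _≥_; z≤n; s≤s)
import Data.Nat.Properties as ℕ
open import Data.Nat.ListAction using (sum)
open import Data.Nat.ListAction.Properties using (sum-++)
open import Data.Integer.Base using (ℤ; +_; -[1+_]; -_; _⊖_; _+_; _≤_; _<_; 0ℤ; 1ℤ; ∣_∣; +≤+; -≤-; +<+)
import Data.Integer.Properties as ℤ
open import Algebra.Properties.AbelianGroup ℤ.+-0-abelianGroup using (∙-cancelʳ)
open import Data.List.Base using (List; []; _∷_; _++_; map; filter; length; foldr; concatMap; replicate; upTo)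
import Data.List.Properties as List
open import Data.List.Extrema.Nat using (max≤v⁺)
open import Data.List.Membership.Propositional using (_∈_; lose; find)
open import Data.List.Membership.Propositional.Properties using (∈-map⁺; ∈-++⁺ˡ; ∈-++⁺ʳ; ∈-++⁻; ∈-∃++; ∈-concatMap⁺; ∈-concatMap⁻; ∈-filter⁺; ∈-filter⁻; ∈-upTo⁺)
open import Data.List.Relation.Unary.All as All using (All; []; _∷_)
import Data.List.Relation.Unary.All.Properties as All
import Data.List.Relation.Unary.AllPairs as AllPairs
import Data.List.Relation.Unary.AllPairs.Properties as AllPairs
open import Data.List.Relation.Unary.Any using (here; there)
open import Data.List.Relation.Unary.Linked using (Linked; []; [-]; _∷_)
open import Data.List.Relation.Unary.Unique.Propositional using (Unique; []; _∷_)
import Data.List.Relation.Unary.Unique.Propositional.Properties as Unique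
open import Data.List.Relation.Binary.Disjoint.Propositional using (Disjoint)
open import Data.Product.Base using (_×_; _,_; proj₂; ∃; ∃₂)
open import Data.Sum.Base using (inj₁; inj₂)
open import Relation.Nullary.Decidable using (yes; no)
open import Relation.Nullary.Negation using (¬_; contradiction)
open import Relation.Binary.PropositionalEquality using (_≡_; refl; sym; trans; cong; subst; module ≡-Reasoning)

-- Partitions with bounded parts, and particles

infixr 5 _⟨_⟩∷_

-- Inside a tail the index is the part just passed, so inductions can go row by row.
data Descending : ℕ → List ℕ → Set where
  []     : ∀ {b} → Descending b []
  _⟨_⟩∷_ : ∀ {b x xs} → 0 ℕ.< x → x ℕ.≤ b → Descending x xs → Descending b (x ∷ xs)

weaken : ∀ {b c xs} → b ℕ.≤ c → Descending b xs → Descending c xs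
weaken b≤c []               = []
weaken b≤c (0<x ⟨ x≤b ⟩∷ d) = 0<x ⟨ ℕ.≤-trans x≤b b≤c ⟩∷ d

Descending⇒≤ : ∀ {b xs} → Descending b xs → All (ℕ._≤ b) xs
Descending⇒≤ []               = []
Descending⇒≤ (0<x ⟨ x≤b ⟩∷ d) = x≤b ∷ Descending⇒≤ (weaken x≤b d)

Descending⇒Linked : ∀ {b xs} → Descending b xs → Linked _≥_ (b ∷ xs)
Descending⇒Linked []             = [-]
Descending⇒Linked (_ ⟨ x≤b ⟩∷ d) = x≤b ∷ Descending⇒Linked d

Descending⇒positive : ∀ {b xs} → Descending b xs → All (ℕ._<_ 0) xs
Descending⇒positive []             = []
Descending⇒positive (0<x ⟨ _ ⟩∷ d) = 0<x ∷ Descending⇒positive d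

Linked⇒Descending : ∀ {b xs} → Linked _≥_ (b ∷ xs) → All (ℕ._<_ 0) xs → Descending b xs
Linked⇒Descending [-]       []          = []
Linked⇒Descending (x≤b ∷ l) (0<x ∷ pos) = 0<x ⟨ x≤b ⟩∷ Linked⇒Descending l pos

Descending⇒IsPartition : ∀ {b xs} → Descending b xs → IsPartition (sum xs) xs
Descending⇒IsPartition d = isPartition (tail (Descending⇒Linked d)) (Descending⇒positive d) refl
  where
  tail : ∀ {x xs} → Linked _≥_ (x ∷ xs) → Linked _≥_ xs
  tail [-]     = []
  tail (_ ∷ l) = l

IsPartition⇒Descending : ∀ {n xs} → IsPartition n xs → Descending n xs
IsPartition⇒Descending {xs = []}     (isPartition _ _ _)      = []
IsPartition⇒Descending {xs = x ∷ xs} (isPartition l pos refl) =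
  Linked⇒Descending (ℕ.m≤m+n x (sum xs) ∷ l) pos

-- The position grows by one with each row passed, which accounts for the offset `s`. The strict
-- inequality in `there` excludes `here`.
data Particle : ℕ → List ℕ → Set where
  here  : ∀ {v xs} → Particle v (v ∷ xs)
  there : ∀ {v x xs} → v ℕ.< x → Particle (suc v) xs → Particle v (x ∷ xs)

-- Merging ones

-- Merge v ys zs: zs arises from ys by breaking the part of the particle at v
-- into ones.
data Merge : ℕ → List ℕ → List ℕ → Set where
  cut  : ∀ {v ys} → Merge v (v ∷ ys) (ys ++ replicate v 1)
  keep : ∀ {v x ys zs} → v ℕ.< x → Merge (suc v) ys zs → Merge v (x ∷ ys) (x ∷ zs)

Merge-functional : ∀ {v ys zs zs′} → Merge v ys zs → Merge v ys zs′ → zs ≡ zs′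
Merge-functional cut          cut           = refl
Merge-functional cut          (keep v<v _)  = contradiction v<v (ℕ.<-irrefl refl)
Merge-functional (keep v<v _) cut           = contradiction v<v (ℕ.<-irrefl refl)
Merge-functional (keep _ r)   (keep _ r′)   = cong (_ ∷_) (Merge-functional r r′)

Merge⇒Particle : ∀ {v ys zs} → Merge v ys zs → Particle v ys
Merge⇒Particle cut          = here
Merge⇒Particle (keep v<x r) = there v<x (Merge⇒Particle r)

sum-replicate-1 : ∀ n → sum (replicate n 1) ≡ n
sum-replicate-1 zero    = refl
sum-replicate-1 (suc n) = cong suc (sum-replicate-1 n)

Merge-sum : ∀ {v ys zs} → Merge v ys zs → sum ys ≡ sum zs
Merge-sum (cut {v} {ys}) = begin
  v ℕ.+ sum ys                    ≡⟨ ℕ.+-comm v (sum ys) ⟩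
  sum ys ℕ.+ v                    ≡⟨ cong (sum ys ℕ.+_) (sum-replicate-1 v) ⟨
  sum ys ℕ.+ sum (replicate v 1)  ≡⟨ sum-++ ys (replicate v 1) ⟨
  sum (ys ++ replicate v 1)       ∎
  where open ≡-Reasoning
Merge-sum (keep _ r) = cong (_ ℕ.+_) (Merge-sum r)

Descending-1 : ∀ {xs} → Descending 1 xs → xs ≡ replicate (ones xs) 1
Descending-1 []                          = refl
Descending-1 (s≤s z≤n ⟨ s≤s z≤n ⟩∷ d) = cong (1 ∷_) (Descending-1 d)

splitOnes : ∀ {b v xs} → Descending b xs → v ℕ.≤ ones xs →
            ∃ λ ys → xs ≡ ys ++ replicate v 1 × Descending b ys
splitOnes {v = zero}  {[]} [] _ = [] , refl , []
splitOnes {v = v} {x ∷ xs} (0<x ⟨ x≤b ⟩∷ d) v≤ with v ℕ.≤? ones xs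
... | yes v≤′ with ys , refl , d′ ← splitOnes d v≤′ = x ∷ ys , refl , (0<x ⟨ x≤b ⟩∷ d′)
... | no v≰ with x ℕ.≟ 1
...   | no x≢1 = contradiction (subst (λ l → v ℕ.≤ length l) (List.filter-reject (ℕ._≟ 1) {xs = xs} x≢1) v≤) v≰
-- The tail has fewer than `v` ones, so the list consists of exactly `v` ones.
...   | yes refl with refl ← ℕ.≤-antisym v≤ (ℕ.≰⇒> v≰) = [] , cong (1 ∷_) (Descending-1 d) , []

partsLargerThan-∷ : ∀ {w x} xs → w ℕ.< x → partsLargerThan w (x ∷ xs) ≡ suc (partsLargerThan w xs)
partsLargerThan-∷ {w} xs w<x = cong length (List.filter-accept (w ℕ.<?_) {xs = xs} w<x)

partsLargerThan-≤ : ∀ {w b xs} → b ℕ.≤ w → Descending b xs → partsLargerThan w xs ≡ 0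
partsLargerThan-≤ {w} b≤w d = cong length
  (List.filter-none (w ℕ.<?_) (All.map (λ x≤b → ℕ.≤⇒≯ (ℕ.≤-trans x≤b b≤w)) (Descending⇒≤ d)))

-- Rows longer than `v` are kept, each raising `v` by one; the merged part goes above the first row
-- that is not. The last inequality is invariant and finally guarantees `v` ones to merge.
mergeOnes : ∀ {b v w xs} → 0 ℕ.< v → v ℕ.≤ b → Descending b xs → ones xs ≡ w →
            partsLargerThan w xs ℕ.+ v ℕ.≤ w → ∃ λ ys → Merge v ys xs × Descending b ys
mergeOnes 0<v _ [] refl v≤0 = contradiction (ℕ.<-≤-trans 0<v v≤0) (ℕ.<-irrefl refl)
mergeOnes {b} {v} {w} {x ∷ xs} 0<v v≤b (0<x ⟨ x≤b ⟩∷ d) eq le with v ℕ.<? x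
... | no v≮x
  with ys , eq′ , d′ ← splitOnes {v = v} (0<x ⟨ ℕ.≮⇒≥ v≮x ⟩∷ d)
                          (subst (v ℕ.≤_) (sym eq) (ℕ.m+n≤o⇒n≤o _ le))
  = v ∷ ys , subst (Merge v (v ∷ ys)) (sym eq′) cut , (0<v ⟨ v≤b ⟩∷ d′)
... | yes v<x = cons (mergeOnes (s≤s z≤n) v<x d eq′ le′)
  where
  cons : (∃ λ ys → Merge (suc v) ys xs × Descending x ys) →
         ∃ λ ys → Merge v ys (x ∷ xs) × Descending b ys
  cons (ys , r , d′) = x ∷ ys , keep v<x r , (0<x ⟨ x≤b ⟩∷ d′)
  eq′ : ones xs ≡ w
  eq′ = trans (cong length (sym (List.filter-reject (ℕ._≟ 1) {x} {xs}
          (λ { refl → ℕ.<⇒≱ 0<v (ℕ.≤-pred v<x) })))) eq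
  le′ : partsLargerThan w xs ℕ.+ suc v ℕ.≤ w
  -- Passing a row longer than `w` lowers the count by one as `v` rises. Otherwise no later part
  -- exceeds `w`, and `v < x ≤ w` suffices.
  le′ with w ℕ.<? x
  ... | yes w<x = ℕ.≤-trans
    (ℕ.≤-reflexive (trans (ℕ.+-suc _ v) (cong (ℕ._+ v) (sym (partsLargerThan-∷ xs w<x))))) le
  ... | no w≮x rewrite partsLargerThan-≤ (ℕ.≮⇒≥ w≮x) d = ℕ.≤-trans v<x (ℕ.≮⇒≥ w≮x)

-- Rows, columns and conjugation

-- Adds one cell to each of the first r rows, or, read transposed, inserts a
-- row of length r.
addColumn : ℕ → List ℕ → List ℕ
addColumn zero    xs       = xs
addColumn (suc r) []       = 1 ∷ addColumn r []
addColumn (suc r) (x ∷ xs) = suc x ∷ addColumn r xs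

sum-addColumn : ∀ r xs → sum (addColumn r xs) ≡ r ℕ.+ sum xs
sum-addColumn zero    xs       = refl
sum-addColumn (suc r) []       = cong suc (sum-addColumn r [])
sum-addColumn (suc r) (x ∷ xs) = cong suc (begin
  x ℕ.+ sum (addColumn r xs)  ≡⟨ cong (x ℕ.+_) (sum-addColumn r xs) ⟩
  x ℕ.+ (r ℕ.+ sum xs)        ≡⟨ ℕ.+-assoc x r (sum xs) ⟨
  x ℕ.+ r ℕ.+ sum xs          ≡⟨ cong (ℕ._+ sum xs) (ℕ.+-comm x r) ⟩
  r ℕ.+ x ℕ.+ sum xs          ≡⟨ ℕ.+-assoc r x (sum xs) ⟩
  r ℕ.+ (x ℕ.+ sum xs)        ∎)
  where open ≡-Reasoning

length-addColumn : ∀ {r} xs → length xs ℕ.≤ r → length (addColumn r xs) ≡ r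
length-addColumn {zero}  []       _        = refl
length-addColumn {suc r} []       _        = cong suc (length-addColumn [] z≤n)
length-addColumn {suc r} (x ∷ xs) (s≤s le) = cong suc (length-addColumn xs le)

Descending-addColumn : ∀ {b r xs} → length xs ℕ.≤ r → Descending b xs → Descending (suc b) (addColumn r xs)
Descending-addColumn {r = zero}  _        []               = []
Descending-addColumn {r = suc r} _        []               =
  s≤s z≤n ⟨ s≤s z≤n ⟩∷ Descending-addColumn z≤n []
Descending-addColumn {r = suc r} (s≤s le) (0<x ⟨ x≤b ⟩∷ d) =
  s≤s z≤n ⟨ s≤s x≤b ⟩∷ Descending-addColumn le d

removeColumn : ∀ {b xs} → Descending (suc b) xs →
  ∃ λ ys → addColumn (length xs) ys ≡ xs × Descending b ys × length ys ℕ.≤ length xs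
removeColumn []                                = [] , refl , [] , z≤n
removeColumn {xs = suc x ∷ xs} (_ ⟨ s≤s x≤b ⟩∷ d) with removeColumn d
removeColumn {xs = suc zero    ∷ xs} (_ ⟨ s≤s x≤b ⟩∷ d) | []    , eq , _ , _ =
  [] , cong (1 ∷_) eq , [] , z≤n
removeColumn {xs = suc zero    ∷ xs} (_ ⟨ s≤s x≤b ⟩∷ d) | _ ∷ _ , _ , (0<y ⟨ y≤0 ⟩∷ _) , _ =
  contradiction (ℕ.<-≤-trans 0<y y≤0) (ℕ.<-irrefl refl)
removeColumn {xs = suc (suc x) ∷ xs} (_ ⟨ s≤s x≤b ⟩∷ d) | ys , eq , d′ , le =
  suc x ∷ ys , cong (_ ∷_) eq , (s≤s z≤n ⟨ x≤b ⟩∷ d′) , s≤s le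

conjugate : List ℕ → List ℕ
conjugate []       = []
conjugate (x ∷ xs) = addColumn x (conjugate xs)

length-conjugate≤ : ∀ {b xs} → Descending b xs → length (conjugate xs) ℕ.≤ b
length-conjugate≤ []             = z≤n
length-conjugate≤ (_ ⟨ x≤b ⟩∷ d) =
  subst (ℕ._≤ _) (sym (length-addColumn _ (length-conjugate≤ d))) x≤b

Descending-conjugate : ∀ {b xs} → Descending b xs → Descending (length xs) (conjugate xs)
Descending-conjugate []           = []
Descending-conjugate (_ ⟨ _ ⟩∷ d) = Descending-addColumn (length-conjugate≤ d) (Descending-conjugate d)

sum-conjugate : ∀ xs → sum (conjugate xs) ≡ sum xs
sum-conjugate []       = refl
sum-conjugate (x ∷ xs) = trans (sum-addColumn x (conjugate xs)) (cong (x ℕ.+_) (sum-conjugate xs))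

-- A new first column becomes a new first row: lengthening a row `x` to `suc x` adds one cell to
-- that first row and leaves the action of `x` on the rest.
conjugate-addColumn : ∀ r xs → length xs ℕ.≤ suc r → conjugate (addColumn (suc r) xs) ≡ suc r ∷ conjugate xs
conjugate-addColumn zero    []       _        = refl
conjugate-addColumn zero    (x ∷ []) _        = refl
conjugate-addColumn zero    (_ ∷ _ ∷ _) (s≤s ())
conjugate-addColumn (suc r) []       _        = cong (addColumn 1) (conjugate-addColumn r [] z≤n)
conjugate-addColumn (suc r) (x ∷ xs) (s≤s le) = cong (addColumn (suc x)) (conjugate-addColumn r xs le)

conjugate-involutive : ∀ {b xs} → Descending b xs → conjugate (conjugate xs) ≡ xs
conjugate-involutive []                           = refl
conjugate-involutive {xs = suc x ∷ xs} (_ ⟨ _ ⟩∷ d) =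
  trans (conjugate-addColumn x (conjugate xs) (length-conjugate≤ d)) (cong (suc x ∷_) (conjugate-involutive d))

-- Raising a particle

-- Lift h v es ys: starting from the partition h ∷ es, the first row has been
-- turned into a first column and a particle, at v + 1 if es had a particle at v
-- and at v if it did not.
data Lift (h : ℕ) : ℕ → List ℕ → List ℕ → Set where
  keep : ∀ {v x es ys} → suc v ℕ.< x → Lift h (suc v) es ys → Lift h v (x ∷ es) (x ∷ ys)
  low  : ∀ {v es} → All (ℕ._< v) es → Lift h v es (v ∷ addColumn (h ∸ v) es)
  high : ∀ {v es} → Lift h v (v ∷ es) (suc v ∷ addColumn (h ∸ suc v) (v ∷ es))

-- The first part of `es` selects the constructor: above `v + 1`, below `v` (or absent), or equal to
-- `v`.
Lift-functional : ∀ {h v es ys ys′} → Lift h v es ys → Lift h v es ys′ → ys ≡ ys′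
Lift-functional (keep _ r)      (keep _ r′)     = cong (_ ∷_) (Lift-functional r r′)
Lift-functional (keep v<x _)    (low (x<v ∷ _)) = contradiction x<v (ℕ.<⇒≯ (ℕ.<⇒≤ v<x))
Lift-functional (keep v<v _)    high            = contradiction v<v (ℕ.<⇒≯ (ℕ.n<1+n _))
Lift-functional (low (x<v ∷ _)) (keep v<x _)    = contradiction x<v (ℕ.<⇒≯ (ℕ.<⇒≤ v<x))
Lift-functional (low _)         (low _)         = refl
Lift-functional (low (v<v ∷ _)) high            = contradiction v<v (ℕ.<-irrefl refl)
Lift-functional high            (keep v<v _)    = contradiction v<v (ℕ.<⇒≯ (ℕ.n<1+n _))
Lift-functional high            (low (v<v ∷ _)) = contradiction v<v (ℕ.<-irrefl refl)
Lift-functional high            high            = refl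

-- The constructors skip a first part `v + 1`. Below a first row `h`, position `v + 1` in `es` is
-- position `v` in `h ∷ es`.
Lift⇒¬Particle : ∀ {h v es ys} → Lift h v es ys → ¬ Particle (suc v) es
Lift⇒¬Particle (keep v<v _)    here          = ℕ.<-irrefl refl v<v
Lift⇒¬Particle (keep _ r)      (there _ p)   = Lift⇒¬Particle r p
Lift⇒¬Particle (low (v<v ∷ _)) here          = ℕ.<⇒≱ v<v (ℕ.n≤1+n _)
Lift⇒¬Particle (low (x<v ∷ _)) (there v<x _) = ℕ.<⇒≯ x<v (ℕ.<⇒≤ v<x)
Lift⇒¬Particle high            (there v<v _) = ℕ.<⇒≱ v<v (ℕ.n≤1+n _)

-- Rows above the chosen one stay; `h` collects the chosen row and one cell from each row below it.
-- Passing a row raises the position and shortens the list by one, so the bound on `h` carries over.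
lift : ∀ {b v ys} → 0 ℕ.< v → Descending b ys → Particle v ys →
  ∃₂ λ h es → v ℕ.+ length ys ℕ.≤ suc h × Lift h v es ys × Descending b es
            × length es ℕ.< length ys × h ℕ.+ sum es ≡ sum ys
lift {v = suc v} {_ ∷ xs} _ (_ ⟨ v≤b ⟩∷ d) here with es , eq , d′ , le ← removeColumn d =
  suc v ℕ.+ length xs , es
  , ℕ.≤-reflexive (ℕ.+-suc (suc v) (length xs))
  , subst (λ l → Lift (suc v ℕ.+ length xs) (suc v) es (suc v ∷ l))
      (trans (cong (λ r → addColumn r es) (ℕ.m+n∸m≡n (suc v) (length xs))) eq)
      (low (All.map s≤s (Descending⇒≤ d′)))
  , weaken (ℕ.≤-trans (ℕ.n≤1+n v) v≤b) d′
  , s≤s le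
  , trans (ℕ.+-assoc (suc v) (length xs) (sum es))
      (cong (suc v ℕ.+_) (trans (sym (sum-addColumn (length xs) es)) (cong sum eq)))
lift {v = v} {x ∷ xs} 0<v (0<x ⟨ x≤b ⟩∷ d) (there v<x p) with suc v ℕ.<? x
... | yes v′<x
  with h , es , h≥ , r , d′ , le , eq ← lift (s≤s z≤n) d p
  = h , x ∷ es
  , subst (ℕ._≤ suc h) (sym (ℕ.+-suc v (length xs))) h≥
  , keep v′<x r , (0<x ⟨ x≤b ⟩∷ d′) , s≤s le
  , (begin
      h ℕ.+ (x ℕ.+ sum es)  ≡⟨ ℕ.+-assoc h x (sum es) ⟨
      h ℕ.+ x ℕ.+ sum es    ≡⟨ cong (ℕ._+ sum es) (ℕ.+-comm h x) ⟩
      x ℕ.+ h ℕ.+ sum es    ≡⟨ ℕ.+-assoc x h (sum es) ⟩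
      x ℕ.+ (h ℕ.+ sum es)  ≡⟨ cong (x ℕ.+_) eq ⟩
      x ℕ.+ sum xs          ∎)
  where open ≡-Reasoning
-- Now `x = v + 1` is a particle at `v + 1`, and the particle at `v` is the equal row right below.
-- The upper row is removed; the lower one shrinks to `v`.
... | no v′≮x with refl ← ℕ.≤-antisym v<x (ℕ.≮⇒≥ v′≮x) with p | d
...   | there v′<y _ | _ ⟨ y≤v′ ⟩∷ _ = contradiction v′<y (ℕ.≤⇒≯ y≤v′)
...   | here {xs = zs} | _ ⟨ _ ⟩∷ d″ with es , eq , d′ , le ← removeColumn d″ =
  suc v ℕ.+ suc (length zs) , v ∷ es
  , ℕ.≤-trans (ℕ.≤-reflexive (ℕ.+-suc v _)) (ℕ.n≤1+n _)
  , subst (λ l → Lift (suc v ℕ.+ suc (length zs)) v (v ∷ es) (suc v ∷ l))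
      (trans (cong (λ r → addColumn r (v ∷ es)) (ℕ.m+n∸m≡n (suc v) (suc (length zs)))) (cong (suc v ∷_) eq))
      high
  , (0<v ⟨ ℕ.≤-trans (ℕ.n≤1+n v) x≤b ⟩∷ d′)
  , s≤s (s≤s le)
  , trans (ℕ.+-assoc (suc v) (suc (length zs)) _)
      (cong (suc v ℕ.+_) (trans (sym (sum-addColumn (suc (length zs)) (v ∷ es))) (cong (λ l → sum (suc v ∷ l)) eq)))

data Raise (k : ℕ) : List ℕ → List ℕ → Set where
  stay : ∀ {es} → Particle k es → Raise k es es
  move : ∀ {h es ys} → k ℕ.< h → Lift h k es ys → Raise k (h ∷ es) ys

-- A particle at `k` in the source tells `stay` from `move`.
Raise-functional : ∀ {k es ys ys′} → Raise k es ys → Raise k es ys′ → ys ≡ ys′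
Raise-functional (stay _)            (stay _)            = refl
Raise-functional (stay here)         (move k<k _)        = contradiction k<k (ℕ.<-irrefl refl)
Raise-functional (stay (there _ p))  (move _ r)          = contradiction p (Lift⇒¬Particle r)
Raise-functional (move k<k _)        (stay here)         = contradiction k<k (ℕ.<-irrefl refl)
Raise-functional (move _ r)          (stay (there _ p))  = contradiction p (Lift⇒¬Particle r)
Raise-functional (move _ r)          (move _ r′)         = Lift-functional r r′

-- If `y` is too short for `stay`, the bound from `lift` makes `h` longer than `y`, hence a valid
-- first row.
raise : ∀ {b j ys} → Descending b ys → Particle (suc j) ys →
  ∃₂ λ h es → Raise (suc j) (h ∷ es) ys × Descending h (h ∷ es)
            × j ℕ.+ length (h ∷ es) ℕ.≤ h × sum (h ∷ es) ≡ sum ys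
raise {j = j} {y ∷ ys} (0<y ⟨ _ ⟩∷ d) p with j ℕ.+ suc (length ys) ℕ.≤? y
... | yes le = y , ys , stay p , (0<y ⟨ ℕ.≤-refl ⟩∷ d) , le , refl
... | no ¬le
  with h , es , h≥ , r , d′ , le , eq ← lift (s≤s z≤n) (0<y ⟨ ℕ.≤-refl ⟩∷ d) p
  = h , es , move (ℕ.≤-<-trans (k≤y p) y<h) r
  , (ℕ.<-trans 0<y y<h ⟨ ℕ.≤-refl ⟩∷ weaken (ℕ.<⇒≤ y<h) d′)
  , ℕ.≤-trans (ℕ.+-monoʳ-≤ j le) (ℕ.≤-pred h≥)
  , eq
  where
  y<h : y ℕ.< h
  y<h = ℕ.<-≤-trans (ℕ.≰⇒> ¬le) (ℕ.≤-pred h≥)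
  k≤y : ∀ {k y ys} → Particle k (y ∷ ys) → k ℕ.≤ y
  k≤y here          = ℕ.≤-refl
  k≤y (there k<y _) = ℕ.<⇒≤ k<y

-- The injection from crank ≤ - suc j to rank ≤ - j

-- Directed from the rank side to the crank side, so that injectivity of the encoding is
-- functionality of this relation.
Encodes : ℕ → List ℕ → List ℕ → Set
Encodes k zs xs = ∃ λ ys → Raise k (conjugate zs) ys × Merge k ys xs

Encodes-functional : ∀ {k zs xs xs′} → Encodes k zs xs → Encodes k zs xs′ → xs ≡ xs′
Encodes-functional (_ , r , s) (_ , r′ , s′) with refl ← Raise-functional r r′ = Merge-functional s s′

⊖≤-⇒+≤ : ∀ a b j → a ⊖ b ≤ -[1+ j ] → a ℕ.+ suc j ℕ.≤ b
⊖≤-⇒+≤ zero    zero    j ()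
⊖≤-⇒+≤ zero    (suc b) j (-≤- j≤b) = s≤s j≤b
⊖≤-⇒+≤ (suc a) zero    j ()
⊖≤-⇒+≤ (suc a) (suc b) j le =
  s≤s (⊖≤-⇒+≤ a b j (subst (_≤ -[1+ j ]) (ℤ.[1+m]⊖[1+n]≡m⊖n a b) le))

crank≤-⇒ : ∀ {j} xs → crank xs ≤ -[1+ j ] → partsLargerThan (ones xs) xs ℕ.+ suc j ℕ.≤ ones xs
crank≤-⇒ xs le with ones xs
crank≤-⇒ xs () | zero
... | suc w = ⊖≤-⇒+≤ (partsLargerThan (suc w) xs) (suc w) _ le

⊖≤-[1+]+1 : ∀ {a b j} → j ℕ.+ a ℕ.≤ b → a ⊖ b ≤ -[1+ j ] + 1ℤ
⊖≤-[1+]+1 {a} {b} {j} le = begin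
  a ⊖ b                    ≤⟨ ℤ.⊖-monoʳ-≥-≤ a le ⟩
  a ⊖ (j ℕ.+ a)            ≡⟨ cong (a ⊖_) (ℕ.+-comm j a) ⟩
  a ⊖ (a ℕ.+ j)            ≡⟨ cong (_⊖ (a ℕ.+ j)) (ℕ.+-identityʳ a) ⟨
  (a ℕ.+ 0) ⊖ (a ℕ.+ j)    ≡⟨ ℤ.+-cancelˡ-⊖ a 0 j ⟩
  0 ⊖ j                    ≡⟨ ℤ.[1+m]⊖[1+n]≡m⊖n 0 j ⟨
  -[1+ j ] + 1ℤ            ∎
  where open ℤ.≤-Reasoning

encode : ∀ {n j xs} → IsPartition n xs → crank xs ≤ -[1+ j ] →
         ∃ λ zs → IsPartition n zs × rank zs ≤ -[1+ j ] + 1ℤ × Encodes (suc j) zs xs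
encode {n} {j} {xs} isP c≤
  -- The bound covers both the parts, at most `n`, and the particle `suc j`, which may become the
  -- first part.
  with ys , merge , d ← mergeOnes {b = n ℕ.+ suc j} (s≤s z≤n) (ℕ.m≤n+m (suc j) n)
                          (weaken (ℕ.m≤m+n n (suc j)) (IsPartition⇒Descending isP)) refl (crank≤-⇒ xs c≤)
  with h , es , rs , d′@(_ ⟨ _ ⟩∷ d″) , le , eq ← raise d (Merge⇒Particle merge)
  = conjugate (h ∷ es)
  , subst (λ s → IsPartition s (conjugate (h ∷ es)))
      (trans (sum-conjugate (h ∷ es)) (trans eq (trans (Merge-sum merge) (IsPartition.sums-to isP))))
      (Descending⇒IsPartition dᶜ)
  , rank≤
  , ys , subst (λ l → Raise (suc j) l ys) (sym (conjugate-involutive d′)) rs , merge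
  where
  dᶜ : Descending (length (h ∷ es)) (conjugate (h ∷ es))
  dᶜ = Descending-conjugate d′
  rank≤ : rank (conjugate (h ∷ es)) ≤ -[1+ j ] + 1ℤ
  -- The conjugate has `h` parts, each at most the number of rows of `h ∷ es`.
  rank≤ rewrite length-addColumn (conjugate es) (length-conjugate≤ d″) =
    ℤ.≤-trans (ℤ.⊖-monoˡ-≤ h (max≤v⁺ z≤n (Descending⇒≤ dᶜ))) (⊖≤-[1+]+1 le)

-- Counting

module _ {A B : Set} (R : B → A → Set) (functional : ∀ {y x x′} → R y x → R y x′ → x ≡ x′) where

  -- By functionality, the `y` serving the first `x` serves no other entry, so it can be deleted
  -- from `ys`.
  length-≤ : ∀ {xs : List A} (ys : List B) → Unique xs →
             (∀ {x} → x ∈ xs → ∃ λ y → y ∈ ys × R y x) → length xs ℕ.≤ length ys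
  length-≤ ys []                  _     = z≤n
  length-≤ ys (x∉xs ∷ unique) total
    with y , y∈ , Ryx ← total (here refl)
    with us , vs , refl ← ∈-∃++ y∈
    rewrite List.length-++-sucʳ us y vs
    = s≤s (length-≤ (us ++ vs) unique λ x′∈ → rest (All.lookup x∉xs x′∈) Ryx (total (there x′∈)))
    where
    rest : ∀ {x x′} → ¬ x ≡ x′ → R y x → (∃ λ y′ → y′ ∈ us ++ y ∷ vs × R y′ x′) →
           ∃ λ y′ → y′ ∈ us ++ vs × R y′ x′
    rest x≢x′ Ryx (y′ , y′∈ , Ry′x′) with ∈-++⁻ us y′∈
    ... | inj₁ ∈us         = y′ , ∈-++⁺ˡ ∈us , Ry′x′
    ... | inj₂ (here refl) = contradiction (functional Ryx Ry′x′) x≢x′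
    ... | inj₂ (there ∈vs) = y′ , ∈-++⁺ʳ us ∈vs , Ry′x′

-- Cumulative counts as lengths of lists

∈-window : ∀ {n} r → ∣ r ∣ ℕ.≤ n → r ∈ window n
∈-window {n} (+ a) a≤n =
  subst (_∈ window n)
    (trans (cong ((n ℕ.+ a) ⊖_) (sym (ℕ.+-identityʳ n))) (ℤ.+-cancelˡ-⊖ n a 0))
    (∈-map⁺ (_⊖ n) (∈-upTo⁺ (s≤s (ℕ.+-monoʳ-≤ n a≤n))))
∈-window {n} -[1+ a ] a<n =
  subst (_∈ window n)
    (trans (ℤ.⊖-≤ (ℕ.m∸n≤m n (suc a))) (cong (λ i → - (+ i)) (ℕ.m∸[m∸n]≡n a<n)))
    (∈-map⁺ (_⊖ n) (∈-upTo⁺ (s≤s (ℕ.≤-trans (ℕ.m∸n≤m n (suc a)) (ℕ.m≤m+n n n)))))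

⊖-injectiveˡ : ∀ n {i j} → i ⊖ n ≡ j ⊖ n → i ≡ j
⊖-injectiveˡ n {i} {j} eq = ℤ.+-injective (∙-cancelʳ (- (+ n)) (+ i) (+ j)
  (trans (ℤ.m-n≡m⊖n i n) (trans eq (sym (ℤ.m-n≡m⊖n j n)))))

window-unique : ∀ n → Unique (window n)
window-unique n = Unique.map⁺ (⊖-injectiveˡ n) (Unique.upTo⁺ (suc (n ℕ.+ n)))

module _ {A : Set} (stat : A → ℤ) (xs : List A) where

  level : ℤ → List A
  level r = filter (λ x → stat x ℤ.≟ r) xs

  levels : List ℤ → List A
  levels = concatMap level

  length-levels : ∀ rs → foldr _+_ 0ℤ (map (λ r → + length (level r)) rs) ≡ + length (levels rs)
  length-levels []       = refl
  length-levels (r ∷ rs) = trans (cong (_+_ (+ length (level r))) (length-levels rs))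
                                 (cong +_ (sym (List.length-++ (level r))))

  ∈-levels⁺ : ∀ {x rs} → x ∈ xs → stat x ∈ rs → x ∈ levels rs
  ∈-levels⁺ x∈ stat∈ = ∈-concatMap⁺ level (lose stat∈ (∈-filter⁺ _ x∈ refl))

  ∈-levels⁻ : ∀ {x} rs → x ∈ levels rs → x ∈ xs × stat x ∈ rs
  ∈-levels⁻ rs x∈
    with r , r∈ , x∈r ← find (∈-concatMap⁻ level {xs = rs} x∈)
    with x∈xs , refl ← ∈-filter⁻ (λ x → stat x ℤ.≟ r) {xs = xs} x∈r
    = x∈xs , r∈

  levels-unique : ∀ {rs} → Unique xs → Unique rs → Unique (levels rs)
  levels-unique {rs} uniqueˣ uniqueʳ = Unique.concat⁺
    (All.map⁺ (All.universal (λ r → Unique.filter⁺ (λ x → stat x ℤ.≟ r) uniqueˣ) rs))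
    (AllPairs.map⁺ (AllPairs.map disjoint uniqueʳ))
    where
    disjoint : ∀ {r s} → ¬ r ≡ s → Disjoint (level r) (level s)
    disjoint {r} {s} r≢s (x∈r , x∈s) =
      r≢s (trans (sym (proj₂ (∈-filter⁻ (λ x → stat x ℤ.≟ r) {xs = xs} x∈r)))
                 (proj₂ (∈-filter⁻ (λ x → stat x ℤ.≟ s) {xs = xs} x∈s)))

crankCount≤N≤ : ∀ j n → sum≤ -[1+ j ] n (λ r → + crankCount r n) ≤ N≤ (-[1+ j ] + 1ℤ) n
crankCount≤N≤ j n
  rewrite length-levels crank (partitions n) (filter (ℤ._≤? -[1+ j ]) (window n))
        | length-levels rank (partitions n) (filter (ℤ._≤? (-[1+ j ] + 1ℤ)) (window n))
  = +≤+ (length-≤ (Encodes (suc j)) (λ {zs} → Encodes-functional {zs = zs}) _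
      (levels-unique crank (partitions n) (partitions-unique n)
        (Unique.filter⁺ (ℤ._≤? -[1+ j ]) (window-unique n)))
      total)
  where
  total : ∀ {xs} → xs ∈ levels crank (partitions n) (filter (ℤ._≤? -[1+ j ]) (window n)) →
    ∃ λ zs → zs ∈ levels rank (partitions n) (filter (ℤ._≤? (-[1+ j ] + 1ℤ)) (window n))
           × Encodes (suc j) zs xs
  total xs∈
    with xs∈ₚ , c∈ ← ∈-levels⁻ crank (partitions n) (filter (ℤ._≤? -[1+ j ]) (window n)) xs∈
    with zs , isP , r≤ , e ← encode (partitions-sound n xs∈ₚ)
                                (proj₂ (∈-filter⁻ (ℤ._≤? -[1+ j ]) {xs = window n} c∈))
    = zs
    , ∈-levels⁺ rank (partitions n) (partitions-complete n isP)
        (∈-filter⁺ (ℤ._≤? (-[1+ j ] + 1ℤ)) (∈-window (rank zs) (rank-bound isP)) r≤)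
    , e

theorem1p4 : (m : ℤ) (n : ℕ) → m < 0ℤ → n ℕ.≥ 1 → M≤ m n ≤ N≤ (m + 1ℤ) n
theorem1p4 (+ _)              _             (+<+ ()) _
-- For `n = 1`, where `M` is a convention and not a count, both sides are evaluated: at `m = -1`
-- both are 1, and below that the left side is 0.
theorem1p4 -[1+ 0 ]           1             _ _ = +≤+ (s≤s z≤n)
theorem1p4 -[1+ 1 ]           1             _ _ = +≤+ z≤n
theorem1p4 -[1+ suc (suc _) ] 1             _ _ = +≤+ z≤n
theorem1p4 -[1+ j ]           (suc (suc n)) _ _ = crankCount≤N≤ j (suc (suc n))
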